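{- For every uncountable cardinal $\kappa$ and every nonempty downward $\preceq$-closed $\mathcal{L}\subseteq\mathrm{LO}_{<\mathrm{cof}(\kappa)}$ such that $\trianglelefteq^{\mathcal{L}}_\kappa$ is transitive, there are at least $2^{\aleph_0}$-many pairwise $\trianglelefteq^{\mathcal{L}}_\kappa$-incomparable $\trianglelefteq^{\mathcal{L}}_\kappa$-minimal elements in $\mathrm{LO}_\kappa$.
   Context: Linear orders are reflexive and nonempty; $L\preceq L'$ means there is an embedding $f:L\to L'$, i.e. $x\le_L y\iff f(x)\le_{L'}f(y)$. For a cardinal $\kappa$, $\mathrm{LO}_\kappa$ is the set of (codes for) linear orders with domain $\kappa$, and $\mathrm{LO}_{<\kappa}=\bigcup_{0<\lambda<\kappa}\mathrm{LO}_\lambda$ ($\lambda$ ranging over cardinals, finite ones included), i.e. the nonempty linear orders of size less than $\kappa$. $\mathrm{cof}(\kappa)$ is the cofinality of $\kappa$. $\mathcal{L}$ is downward $\preceq$-closed if whenever $K$ is a nonempty linear order and $K\preceq L\in\mathcal{L}$ then $K\in\mathcal{L}$; membership is meant up to isomorphism. A subset $I$ of $L$ is convex if $x\le_L y\le_L z$ and $x,z\in I$ imply $y\in I$. A $K$-convex partition of $L$ is a partition $(L_k)_{k\in K}$ of $L$ (into nonempty sets) such that $k<_K k'\iff$ every element of $L_k$ is $<_L$ every element of $L_{k'}$. $L\trianglelefteq^{\mathcal{L}}L'$ iff there are $K\in\mathcal{L}$, a $K$-convex partition $(L_k)_{k\in K}$ of $L$, and an embedding $f$ of $L$ into $L'$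 such that each $f(L_k)$ is a convex subset of $L'$. $\trianglelefteq^{\mathcal{L}}_\kappa$ is the restriction of $\trianglelefteq^{\mathcal{L}}$ to $\mathrm{LO}_\kappa$. An element $L$ is $\trianglelefteq^{\mathcal{L}}_\kappa$-minimal if there is no $L'\in\mathrm{LO}_\kappa$ with $L'\trianglelefteq^{\mathcal{L}}_\kappa L$ and $L\not\trianglelefteq^{\mathcal{L}}_\kappa L'$. -}

module Defs where

open import Level using (Level; _⊔_; suc)
open import Data.Nat.Base using (ℕ)
open import Data.Product.Base using (Σ; ∃; _×_; _,_)
open import Function.Bundles using (_↣_; _⤖_; _⇔_; Injection)
open import Induction.WellFounded using (WellFounded)
open import Relation.Binary.Core using (Rel)
open import Relation.Binary.Structures using (IsTotalOrder; IsStrictTotalOrder)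
open import Relation.Binary.PropositionalEquality.Core using (_≡_)
open import Relation.Nullary.Negation.Core using (¬_)
open import Relation.Unary using (Pred; _∈_; Irrelevant)
import Relation.Binary.Construct.NonStrictToStrict as ToStrict
import Relation.Binary.Construct.StrictToNonStrict as ToNonStrict

private
  variable
    a b p : Level

-- |A| < |B|, in the choice-free form: A injects into B but not conversely.

_<ᶜ_ : Set a → Set b → Set (a ⊔ b)
A <ᶜ B = (A ↣ B) × ¬ (B ↣ A)

-- Cardinals are initial ordinals: well-orders that do not inject into any
-- of their proper initial segments.  The segment {x | x < b} is not formed as
-- a Σ-type because proofs of x < b need not be unique.

record Cardinal (a : Level) : Set (suc a) where
  infix 4 _<_
  field
    Carrier            : Set a
    _<_                : Rel Carrier a
    isStrictTotalOrder : IsStrictTotalOrder _≡_ _<_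
    wellFounded        : WellFounded _<_
    initial            : ∀ b → ¬ Σ (Carrier ↣ Carrier) λ f → ∀ x → Injection.to f x < b

  open ToNonStrict _≡_ _<_ public using (_≤_)

open Cardinal using () renaming (Carrier to ∣_∣)

Uncountable : Cardinal a → Set a
Uncountable κ = ¬ (∣ κ ∣ ↣ ℕ)

-- Irrelevance makes ∃ C a genuine subset of κ, so that its size is the size
-- of the subset rather than that of a type of proofs.

record CofinalSubset (κ : Cardinal a) : Set (suc a) where
  open Cardinal κ using (_≤_)
  field
    C          : Pred ∣ κ ∣ a
    irrelevant : Irrelevant C
    cofinal    : ∀ x → ∃ λ y → y ∈ C × x ≤ y

-- IsCofinality κ μ says that μ = cof(κ), the least cardinality of a cofinal
-- subset of κ.

record IsCofinality (κ μ : Cardinal a) : Set (suc a) where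
  field
    attained : Σ (CofinalSubset κ) λ D → ∃ (CofinalSubset.C D) ⤖ ∣ μ ∣
    least    : (D : CofinalSubset κ) → ∣ μ ∣ ↣ ∃ (CofinalSubset.C D)

record LinearOrderOn (A : Set a) : Set (suc a) where
  infix 4 _≤_
  field
    _≤_          : Rel A a
    isTotalOrder : IsTotalOrder _≡_ _≤_
    nonempty     : A

  open ToStrict _≡_ _≤_ public using (_<_)

record LinearOrder (a : Level) : Set (suc a) where
  constructor ⌊_⌋
  field
    {Carrier} : Set a
    order     : LinearOrderOn Carrier

  open LinearOrderOn order public

open LinearOrder using () renaming (Carrier to dom)

LO : Cardinal a → Set (suc a)
LO κ = LinearOrderOn ∣ κ ∣

-- Membership up to isomorphism: the domain may be any type of size less
-- than μ.

LO< : Cardinal a → Pred (LinearOrder a) a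
LO< μ L = dom L <ᶜ ∣ μ ∣

IsEmbedding : (L L′ : LinearOrder a) → (dom L → dom L′) → Set a
IsEmbedding L L′ f = ∀ x y → (x L.≤ y) ⇔ (f x L′.≤ f y)
  where
  module L  = LinearOrder L
  module L′ = LinearOrder L′

_≼_ : Rel (LinearOrder a) a
L ≼ L′ = ∃ (IsEmbedding L L′)

DownwardClosed : Pred (LinearOrder a) p → Set (suc a ⊔ p)
DownwardClosed 𝓛 = ∀ {K L} → K ≼ L → L ∈ 𝓛 → K ∈ 𝓛

Convex : (L : LinearOrder a) → Pred (Pred (dom L) a) a
Convex L I = ∀ {x y z} → x ≤ y → y ≤ z → x ∈ I → z ∈ I → y ∈ I
  where open LinearOrder L

record ConvexPartition (K L : LinearOrder a) : Set (suc a) where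
  private
    module K = LinearOrder K
    module L = LinearOrder L
  field
    part     : dom K → Pred (dom L) a
    inhabits : ∀ k → ∃ (part k)
    covers   : ∀ x → ∃ λ k → x ∈ part k
    disjoint : ∀ {k k′ x} → x ∈ part k → x ∈ part k′ → k ≡ k′
    ordered  : ∀ k k′ →
               (k K.< k′) ⇔ (∀ {x y} → x ∈ part k → y ∈ part k′ → x L.< y)

Image : {A B : Set a} → (A → B) → Pred A a → Pred B a
Image f P y = ∃ λ x → x ∈ P × f x ≡ y

_⊴⟨_⟩_ : LinearOrder a → Pred (LinearOrder a) p → LinearOrder a → Set (suc a ⊔ p)
L ⊴⟨ 𝓛 ⟩ L′ =
  Σ (LinearOrder _) λ K → K ∈ 𝓛 ×
  Σ (ConvexPartition K L) λ P →
  Σ (dom L → dom L′) λ f →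
    IsEmbedding L L′ f × (∀ k → Convex L′ (Image f (ConvexPartition.part P k)))

Restricted⊴ : Pred (LinearOrder a) p → (κ : Cardinal a) → Rel (LO κ) (suc a ⊔ p)
Restricted⊴ 𝓛 κ L L′ = ⌊ L ⌋ ⊴⟨ 𝓛 ⟩ ⌊ L′ ⌋

Incomparable : {A : Set a} → Rel A b → Rel A b
Incomparable _R_ x y = ¬ (x R y) × ¬ (y R x)

Minimal : {A : Set a} → Rel A b → Pred A (a ⊔ b)
Minimal _R_ x = ¬ ∃ λ y → (y R x) × ¬ (x R y)

{-# OPTIONS --safe #-}
module Submission where

-- Each bit sequence s is coded by a countable order, the word of s: the sum
-- over k in ℕ of the blocks ω* + ω + (2k + s(k) + 1).  Let ⟦ s ⟧ be the sum of
-- κ copies of the word of s.  It has size κ, and F s is its transport to κ.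
--
-- Every L of size κ with L ⊴ ⟦ s ⟧ contains a copy of ⟦ s ⟧ as a convex subset
-- (⊴F⇒≼ᶜ).  Let e : L → ⟦ s ⟧ witness L ⊴ ⟦ s ⟧.  The image of e is unbounded,
-- because a bounded subset of ⟦ s ⟧ has size less than κ
-- (no-small-injection).  The partition has fewer than cof(κ) parts, so the
-- image of some part is already unbounded (unbounded-part), and being convex
-- it contains a tail of ⟦ s ⟧.  Any tail of κ contains a copy of κ as an
-- interval (Shift), so ⟦ s ⟧ embeds convexly into that tail and thus, by
-- inverting e, into L.  Since 𝓛 contains the one-point order, a convex
-- embedding of ⟦ s ⟧ into L yields ⟦ s ⟧ ⊴ L (≼ᶜ⇒⊴); so F s is minimal.
--
-- If F s ⊴ F t, the same argument embeds ⟦ t ⟧ convexly into ⟦ s ⟧.  Convex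
-- embeddings preserve finite chains of immediate successors whose first element
-- is a limit from the left and whose last element is a limit from the right.
-- In ⟦ s ⟧ these chains are exactly the finite parts of the blocks, so the
-- numbers 2k + t(k) all occur among the numbers 2k + s(k), whence s = t
-- (convex-embedding⇒≗).
--
-- The cardinal arithmetic rests on an injection κ × ℕ → κ that is bounded on
-- bounded sets (absorb): it writes an element as the n-th successor of a limit
-- and replaces n by a code of a pair.  It is total and bounded because there is
-- no greatest limit, which is where uncountability enters (Hotel).

open import Defs
open import Axiom.ExcludedMiddle using (ExcludedMiddle)
open import Data.Bool.Base using (Bool; true; false; if_then_else_)
open import Data.Bool.Properties using (T-irrelevant)
open import Data.Empty using (⊥)
open import Data.Fin.Base as Fin using (Fin; zero; suc; toℕ; fromℕ; inject₁)
open import Data.Fin.Patterns using (0F; 1F; 2F)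
import Data.Fin.Induction as Fin
import Data.Fin.Properties as Fin
open import Data.Fin.Relation.Unary.Top using (view; ‵fromℕ; ‵inject₁)
open import Data.Nat.Base as ℕ using (ℕ; zero; suc)
import Data.Nat.Properties as ℕ
open import Data.Product.Base using (Σ; ∃; ∃₂; _×_; _,_; proj₁; proj₂)
open import Data.Sum.Base using (_⊎_; inj₁; inj₂)
open import Data.Unit.Polymorphic.Base using (⊤; tt)
open import Function.Base using (id; _∘_; flip)
open import Function.Bundles
  using (_↣_; _↔_; Injection; Inverse; Equivalence; mk↣; mk↔ₛ′; mk⇔)
open import Function.Definitions using (Injective)
open import Induction.WellFounded using (Acc; acc)
open import Level using (Level; _⊔_; Lift; lift; lower)
open import Relation.Binary.Core using (Rel)
open import Relation.Binary.Definitions using (Transitive; Trichotomous; tri<; tri≈; tri>)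
open import Relation.Binary.PropositionalEquality.Core
  using (_≡_; _≢_; _≗_; refl; sym; trans; cong; subst)
open import Relation.Binary.PropositionalEquality.Properties using (isEquivalence)
open import Relation.Binary.Structures using (IsTotalOrder; IsStrictTotalOrder)
open import Relation.Binary.Structures.Biased using (isStrictTotalOrderᶜ)
import Relation.Binary.Construct.Flip.EqAndOrd as Flip
import Relation.Binary.Construct.StrictToNonStrict as ToNonStrict
open import Relation.Nullary.Decidable.Core
  using (yes; no; True; toWitness; fromWitness; decidable-stable)
open import Relation.Nullary.Negation.Core using (¬_; contradiction)
open import Relation.Unary using (Pred; _∈_; _⊆_; Satisfiable)

private
  variable
    a b i r r′ p : Level

-- Injective codes for pairs

-- The number 2n + b.
enc : Bool → ℕ → ℕ
enc b zero    = if b then 1 else 0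
enc b (suc n) = suc (suc (enc b n))

enc-injective : ∀ b c m n → enc b m ≡ enc c n → b ≡ c × m ≡ n
enc-injective false false zero    zero    eq = refl , refl
enc-injective true  true  zero    zero    eq = refl , refl
enc-injective false true  zero    zero    ()
enc-injective true  false zero    zero    ()
enc-injective false c     zero    (suc n) ()
enc-injective true  c     zero    (suc n) ()
enc-injective b     false (suc m) zero    ()
enc-injective b     true  (suc m) zero    ()
enc-injective b     c     (suc m) (suc n) eq
  with enc-injective b c m n (ℕ.suc-injective (ℕ.suc-injective eq))
... | b≡c , m≡n = b≡c , cong suc m≡n

-- An injective pairing: pair m n is (2n + 1) 2^m.
pair : ℕ → ℕ → ℕ
pair zero    n = enc true n
pair (suc m) n = enc false (pair m n)

pair-injective : ∀ m n m′ n′ → pair m n ≡ pair m′ n′ → m ≡ m′ × n ≡ n′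
pair-injective zero n zero n′ eq = refl , proj₂ (enc-injective true true n n′ eq)
pair-injective zero n (suc m′) n′ eq
  with () ← proj₁ (enc-injective true false n (pair m′ n′) eq)
pair-injective (suc m) n zero n′ eq
  with () ← proj₁ (enc-injective false true (pair m n) n′ eq)
pair-injective (suc m) n (suc m′) n′ eq
  with pair-injective m n m′ n′
         (proj₂ (enc-injective false false (pair m n) (pair m′ n′) eq))
... | m≡m′ , n≡n′ = cong suc m≡m′ , n≡n′

Σ-encode : {I : Set i} {B : I → Set b} → (I → ℕ) → (∀ i → B i → ℕ) → Σ I B → ℕ
Σ-encode e f (i , x) = pair (e i) (f i x)

Σ-encode-injective : {I : Set i} {B : I → Set b} (e : I → ℕ) (f : ∀ i → B i → ℕ) →
                     Injective _≡_ _≡_ e → (∀ i → Injective _≡_ _≡_ (f i)) →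
                     Injective _≡_ _≡_ (Σ-encode {B = B} e f)
Σ-encode-injective e f e-inj f-inj {i , x} {j , y} eq
  with pair-injective (e i) (f i x) (e j) (f j y) eq
... | ei≡ej , fx≡fy with e-inj ei≡ej
... | refl = cong (i ,_) (f-inj i fx≡fy)

-- Immediate successors and limits in a strict order
module _ {A : Set a} (_<_ : Rel A r) where

  -- Cover x y: y is the immediate successor of x.
  Cover : Rel A (a ⊔ r)
  Cover x y = x < y × (∀ z → x < z → ¬ (z < y))

  NoPredecessor NoSuccessor : Pred A (a ⊔ r)
  NoPredecessor x = ∀ y → ¬ Cover y x
  NoSuccessor   x = ∀ y → ¬ Cover x y

  -- Steps x n y: y is the n-th iterated immediate successor of x.
  data Steps (x : A) : ℕ → A → Set (a ⊔ r) where
    stay : Steps x 0 x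
    step : ∀ {n y z} → Steps x n y → Cover y z → Steps x (suc n) z

  -- Limits from the left and from the right.  The least element is not a
  -- limit from the left, nor the greatest one from the right; unlike NoPredecessor
  -- and NoSuccessor, these notions are therefore preserved by convex embeddings.
  LeftLimit RightLimit : Pred A (a ⊔ r)
  LeftLimit  x = (∃ λ y → y < x) × (∀ y → y < x → ∃ λ z → y < z × z < x)
  RightLimit x = (∃ λ y → x < y) × (∀ y → x < y → ∃ λ z → x < z × z < y)

  LeftLimit⇒NoPredecessor : ∀ {x} → LeftLimit x → NoPredecessor x
  LeftLimit⇒NoPredecessor (_ , dense) y (y<x , gap) with dense y y<x
  ... | z , y<z , z<x = gap z y<z z<x

  RightLimit⇒NoSuccessor : ∀ {x} → RightLimit x → NoSuccessor x
  RightLimit⇒NoSuccessor (_ , dense) y (x<y , gap) with dense y x<y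
  ... | z , x<z , z<y = gap z x<z z<y

module _ {A : Set a} {_<_ : Rel A r} (O : IsStrictTotalOrder _≡_ _<_) where
  private module O = IsStrictTotalOrder O

  predecessor-unique : ∀ {x y z} → Cover _<_ x z → Cover _<_ y z → x ≡ y
  predecessor-unique {x} {y} (x<z , x-gap) (y<z , y-gap) with O.compare x y
  ... | tri< x<y _ _ = contradiction y<z (x-gap y x<y)
  ... | tri≈ _ x≡y _ = x≡y
  ... | tri> _ _ y<x = contradiction x<z (y-gap x y<x)

  successor-unique : ∀ {x y z} → Cover _<_ x y → Cover _<_ x z → y ≡ z
  successor-unique {x} {y} {z} (x<y , y-gap) (x<z , z-gap) with O.compare y z
  ... | tri< y<z _ _ = contradiction y<z (z-gap y x<y)
  ... | tri≈ _ y≡z _ = y≡z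
  ... | tri> _ _ z<y = contradiction z<y (y-gap z x<z)

  steps-functional : ∀ {b n x y} → Steps _<_ b n x → Steps _<_ b n y → x ≡ y
  steps-functional stay       stay       = refl
  steps-functional (step s c) (step t d) with steps-functional s t
  ... | refl = successor-unique c d

  -- A representation as an iterated successor of an element without predecessor is
  -- unique.  It yields both the decomposition of ordinals into a limit and a
  -- natural number, and the length of an isolated finite chain.
  steps-unique : ∀ {b c m n x} → NoPredecessor _<_ b → NoPredecessor _<_ c →
                 Steps _<_ b m x → Steps _<_ c n x → b ≡ c × m ≡ n
  steps-unique nb nc stay       stay       = refl , refl
  steps-unique nb nc stay       (step _ d) = contradiction d (nb _)
  steps-unique nb nc (step _ d) stay       = contradiction d (nc _)
  steps-unique nb nc (step s d) (step t e) with predecessor-unique d e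
  ... | refl with steps-unique nb nc s t
  ... | refl , refl = refl , refl

  steps-≤ : ∀ {b n x} → Steps _<_ b n x → b < x ⊎ b ≡ x
  steps-≤ stay = inj₂ refl
  steps-≤ (step s (y<x , _)) with steps-≤ s
  ... | inj₁ b<y  = inj₁ (O.trans b<y y<x)
  ... | inj₂ refl = inj₁ y<x

  steps-below : ∀ {b c n x} → NoPredecessor _<_ c → b < c → Steps _<_ b n x → x < c
  steps-below nc b<c stay = b<c
  steps-below {c = c} {x = x} nc b<c (step {y = y} s y⋖x) with O.compare x c
  ... | tri< x<c _ _  = x<c
  ... | tri≈ _ refl _ = contradiction y⋖x (nc y)
  ... | tri> _ _ c<x  = contradiction c<x (proj₂ y⋖x c (steps-below nc b<c s))

-- Lexicographic sums

-- The strict order of the sum over I of the family B.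
module Lex {I : Set i} {B : I → Set b} (_<ᴵ_ : Rel I r) (_<ᴮ_ : ∀ {i} → Rel (B i) r′) where

  data _≺_ : Rel (Σ I B) (i ⊔ b ⊔ r ⊔ r′) where
    base  : ∀ {i j x y} → i <ᴵ j → (i , x) ≺ (j , y)
    fibre : ∀ {i x y} → x <ᴮ y → (i , x) ≺ (i , y)

  module _ (OI : IsStrictTotalOrder _≡_ _<ᴵ_)
           (OB : ∀ i → IsStrictTotalOrder _≡_ (_<ᴮ_ {i})) where
    private
      module OI = IsStrictTotalOrder OI
      module OB i = IsStrictTotalOrder (OB i)

    ≺-trans : Transitive _≺_
    ≺-trans (base p)  (base q)  = base (OI.trans p q)
    ≺-trans (base p)  (fibre q) = base p
    ≺-trans (fibre p) (base q)  = base q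
    ≺-trans (fibre p) (fibre q) = fibre (OB.trans _ p q)

    ≺-irrefl : ∀ {x} → ¬ (x ≺ x)
    ≺-irrefl (base p)  = OI.irrefl refl p
    ≺-irrefl (fibre p) = OB.irrefl _ refl p

    ≺-compare : Trichotomous _≡_ _≺_
    ≺-compare x y = go x y
      where
      lt : ∀ {x y} → x ≺ y → _
      lt {x} {y} p = tri< {A = x ≺ y} {B = x ≡ y} {C = y ≺ x} p
                       (λ { refl → ≺-irrefl p }) (λ q → ≺-irrefl (≺-trans p q))
      gt : ∀ {x y} → y ≺ x → _
      gt {x} {y} p = tri> {A = x ≺ y} {B = x ≡ y} {C = y ≺ x}
                       (λ q → ≺-irrefl (≺-trans p q)) (λ { refl → ≺-irrefl p }) p
      go : Trichotomous _≡_ _≺_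
      go (i , x) (j , y) with OI.compare i j
      ... | tri< i<j _ _ = lt (base i<j)
      ... | tri> _ _ j<i = gt (base j<i)
      ... | tri≈ _ refl _ with OB.compare i x y
      ...   | tri< x<y _ _  = lt (fibre x<y)
      ...   | tri> _ _ y<x  = gt (fibre y<x)
      ...   | tri≈ _ refl _ = tri≈ ≺-irrefl refl ≺-irrefl

    isStrictTotalOrder : IsStrictTotalOrder _≡_ _≺_
    isStrictTotalOrder = isStrictTotalOrderᶜ record
      { isEquivalence = isEquivalence ; trans = ≺-trans ; compare = ≺-compare }

    fibre-cover : ∀ {i} {x y : B i} → Cover _<ᴮ_ x y → Cover _≺_ (i , x) (i , y)
    fibre-cover {i} {x} {y} (x<y , gap) = fibre x<y , lex-gap
      where
      lex-gap : ∀ z → (i , x) ≺ z → ¬ (z ≺ (i , y))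
      lex-gap _ (base p)  (base q)  = OI.asym p q
      lex-gap _ (base p)  (fibre q) = OI.irrefl refl p
      lex-gap _ (fibre p) (base q)  = OI.irrefl refl q
      lex-gap _ (fibre p) (fibre q) = gap _ p q

    fibre-steps : ∀ {i n} {x y : B i} → Steps _<ᴮ_ x n y → Steps _≺_ (i , x) n (i , y)
    fibre-steps stay       = stay
    fibre-steps (step s c) = step (fibre-steps s) (fibre-cover c)

  fibre-leftLimit : ∀ {i} {x : B i} → LeftLimit _<ᴮ_ x → LeftLimit _≺_ (i , x)
  fibre-leftLimit {i} {x} ((y , y<x) , dense) = ((i , y) , fibre y<x) , lex-dense
    where
    lex-dense : ∀ z → z ≺ (i , x) → ∃ λ w → z ≺ w × w ≺ (i , x)
    lex-dense _ (base p)  = (i , y) , base p , fibre y<x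
    lex-dense _ (fibre p) with dense _ p
    ... | w , z<w , w<x = (i , w) , fibre z<w , fibre w<x

  fibre-rightLimit : ∀ {i} {x : B i} → RightLimit _<ᴮ_ x → RightLimit _≺_ (i , x)
  fibre-rightLimit {i} {x} ((y , x<y) , dense) = ((i , y) , fibre x<y) , lex-dense
    where
    lex-dense : ∀ z → (i , x) ≺ z → ∃ λ w → (i , x) ≺ w × w ≺ z
    lex-dense _ (base p)  = (i , y) , fibre x<y , base p
    lex-dense _ (fibre p) with dense _ p
    ... | w , x<w , w<z = (i , w) , fibre x<w , fibre w<z

-- Invariants of convex embeddings

module _ {A : Set a} {B : Set b} {_<₁_ : Rel A r} {_<₂_ : Rel B r′}
         (O₂ : IsStrictTotalOrder _≡_ _<₂_) (g : A → B)
         (mono    : ∀ {x y} → x <₁ y → g x <₂ g y)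
         (reflect : ∀ {x y} → g x <₂ g y → x <₁ y)
         (convex  : ∀ {x y z} → g x <₂ z → z <₂ g y → ∃ λ w → g w ≡ z) where
  private module O₂ = IsStrictTotalOrder O₂

  preserves-cover : ∀ {x y} → Cover _<₁_ x y → Cover _<₂_ (g x) (g y)
  preserves-cover {x} {y} (x<y , gap) = mono x<y , gap′
    where
    gap′ : ∀ z → g x <₂ z → ¬ (z <₂ g y)
    gap′ z p q with convex p q
    ... | w , refl = gap w (reflect p) (reflect q)

  preserves-steps : ∀ {x n y} → Steps _<₁_ x n y → Steps _<₂_ (g x) n (g y)
  preserves-steps stay       = stay
  preserves-steps (step s c) = step (preserves-steps s) (preserves-cover c)

  -- A point z below g x either lies below g y, for a fixed y below x, or is in the
  -- image by convexity.
  preserves-leftLimit : ∀ {x} → LeftLimit _<₁_ x → LeftLimit _<₂_ (g x)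
  preserves-leftLimit {x} ((y , y<x) , dense) = (g y , mono y<x) , dense′
    where
    dense′ : ∀ z → z <₂ g x → ∃ λ w → z <₂ w × w <₂ g x
    dense′ z z<gx with O₂.compare z (g y)
    ... | tri< z<gy _ _ = g y , z<gy , mono y<x
    ... | tri≈ _ refl _ with dense y y<x
    ...   | w , y<w , w<x = g w , mono y<w , mono w<x
    dense′ z z<gx | tri> _ _ gy<z with convex gy<z z<gx
    ...   | v , refl with dense v (reflect z<gx)
    ...     | w , v<w , w<x = g w , mono v<w , mono w<x

  preserves-rightLimit : ∀ {x} → RightLimit _<₁_ x → RightLimit _<₂_ (g x)
  preserves-rightLimit {x} ((y , x<y) , dense) = (g y , mono x<y) , dense′
    where
    dense′ : ∀ z → g x <₂ z → ∃ λ w → g x <₂ w × w <₂ z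
    dense′ z gx<z with O₂.compare z (g y)
    ... | tri> _ _ gy<z = g y , mono x<y , gy<z
    ... | tri≈ _ refl _ with dense y x<y
    ...   | w , x<w , w<y = g w , mono x<w , mono w<y
    dense′ z gx<z | tri< z<gy _ _ with convex gx<z z<gy
    ...   | v , refl with dense v (reflect gx<z)
    ...     | w , x<w , w<v = g w , mono x<w , mono w<v

-- The countable orders coding bit sequences

-- The three parts of a block: ω*, ω, and a finite chain with N + 1 elements.
Part : ℕ → Fin 3 → Set
Part N 0F = ℕ
Part N 1F = ℕ
Part N 2F = Fin (suc N)

_<ᴾ_ : ∀ {N i} → Rel (Part N i) Level.zero
_<ᴾ_ {N} {0F} = flip ℕ._<_
_<ᴾ_ {N} {1F} = ℕ._<_
_<ᴾ_ {N} {2F} = Fin._<_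

<ᴾ-isStrictTotalOrder : ∀ N i → IsStrictTotalOrder _≡_ (_<ᴾ_ {N} {i})
<ᴾ-isStrictTotalOrder N 0F = isStrictTotalOrderᶜ record
  { isEquivalence = isEquivalence
  ; trans         = flip ℕ.<-trans
  ; compare       = IsStrictTotalOrder.compare (Flip.isStrictTotalOrder ℕ.<-isStrictTotalOrder) }
<ᴾ-isStrictTotalOrder N 1F = ℕ.<-isStrictTotalOrder
<ᴾ-isStrictTotalOrder N 2F = Fin.<-isStrictTotalOrder

-- The order ω* + ω + (N + 1).
Block : ℕ → Set
Block N = Σ (Fin 3) (Part N)

module Blk N = Lex {B = Part N} Fin._<_ _<ᴾ_

_<ᴮ_ : ∀ {N} → Rel (Block N) Level.zero
_<ᴮ_ {N} = Blk._≺_ N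

<ᴮ-isStrictTotalOrder : ∀ N → IsStrictTotalOrder _≡_ (_<ᴮ_ {N})
<ᴮ-isStrictTotalOrder N = Blk.isStrictTotalOrder N Fin.<-isStrictTotalOrder (<ᴾ-isStrictTotalOrder N)

module _ {N : ℕ} where

  -- The endpoints of the finite part.
  first last : Block N
  first = 2F , zero
  last  = 2F , fromℕ N

  down-cover : ∀ n → Cover (_<ᴮ_ {N}) (0F , suc n) (0F , n)
  down-cover n = Blk.fibre-cover N Fin.<-isStrictTotalOrder (<ᴾ-isStrictTotalOrder N)
                   (ℕ.≤-refl , λ z z<1+n n<z → ℕ.<⇒≱ n<z (ℕ.s≤s⁻¹ z<1+n))

  down-up-cover : Cover (_<ᴮ_ {N}) (0F , 0) (1F , 0)
  down-up-cover = Blk.base (ℕ.s≤s ℕ.z≤n) , gap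
    where
    gap : ∀ z → (0F , 0) <ᴮ z → ¬ (z <ᴮ (1F , 0))
    gap (0F , _) (Blk.fibre ()) _
    gap (1F , _) _ (Blk.fibre ())
    gap (1F , _) _ (Blk.base (ℕ.s≤s ()))
    gap (2F , _) _ (Blk.base (ℕ.s≤s ()))

  up-cover : ∀ n → Cover (_<ᴮ_ {N}) (1F , n) (1F , suc n)
  up-cover n = Blk.fibre-cover N Fin.<-isStrictTotalOrder (<ᴾ-isStrictTotalOrder N)
                 (ℕ.≤-refl , λ z n<z z<1+n → ℕ.<⇒≱ n<z (ℕ.s≤s⁻¹ z<1+n))

  finite-cover : ∀ j → Cover (_<ᴮ_ {N}) (2F , inject₁ j) (2F , suc j)
  finite-cover j = Blk.fibre-cover N Fin.<-isStrictTotalOrder (<ᴾ-isStrictTotalOrder N)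
    ( Fin.≤̄⇒inject₁< ℕ.≤-refl
    , λ z j<z z<1+j → ℕ.<⇒≱ (subst (ℕ._< toℕ z) (Fin.toℕ-inject₁ j) j<z) (ℕ.s≤s⁻¹ z<1+j))

  -- Only the last element of the finite part lacks an immediate successor within
  -- the block.
  last-or-covered : ∀ x → x ≡ last ⊎ ∃ (Cover (_<ᴮ_ {N}) x)
  last-or-covered (0F , zero)  = inj₂ (_ , down-up-cover)
  last-or-covered (0F , suc n) = inj₂ (_ , down-cover n)
  last-or-covered (1F , n)     = inj₂ (_ , up-cover n)
  last-or-covered (2F , j) with view j
  ... | ‵fromℕ     = inj₁ refl
  ... | ‵inject₁ k = inj₂ (_ , finite-cover k)

  block-unbounded-below : ∀ (x : Block N) → ∃ λ y → y <ᴮ x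
  block-unbounded-below (0F , n) = (0F , suc n) , Blk.fibre ℕ.≤-refl
  block-unbounded-below (1F , n) = (0F , 0) , Blk.base (ℕ.s≤s ℕ.z≤n)
  block-unbounded-below (2F , j) = (0F , 0) , Blk.base (ℕ.s≤s ℕ.z≤n)

  last-maximum : ∀ y → ¬ (last <ᴮ y)
  last-maximum (0F , _) (Blk.base ())
  last-maximum (1F , _) (Blk.base (ℕ.s≤s ()))
  last-maximum (2F , _) (Blk.base (ℕ.s≤s (ℕ.s≤s ())))
  last-maximum (2F , j) (Blk.fibre p) = ℕ.<⇒≱ p (Fin.≤fromℕ j)

  first-leftLimit : LeftLimit (_<ᴮ_ {N}) first
  first-leftLimit = block-unbounded-below first , dense
    where
    dense : ∀ y → y <ᴮ first → ∃ λ z → y <ᴮ z × z <ᴮ first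
    dense (0F , n) _ = (1F , 0) , Blk.base (ℕ.s≤s ℕ.z≤n) , Blk.base (ℕ.s≤s (ℕ.s≤s ℕ.z≤n))
    dense (1F , n) _ = (1F , suc n) , Blk.fibre ℕ.≤-refl , Blk.base (ℕ.s≤s (ℕ.s≤s ℕ.z≤n))
    dense (2F , _) (Blk.base (ℕ.s≤s (ℕ.s≤s ())))
    dense (2F , _) (Blk.fibre ())

  steps-to-finite : ∀ j → Steps (_<ᴮ_ {N}) first (toℕ j) (2F , j)
  steps-to-finite = Fin.<-weakInduction (λ j → Steps _<ᴮ_ first (toℕ j) (2F , j)) stay
    λ j s → step (subst (λ n → Steps _<ᴮ_ first n (2F , inject₁ j)) (Fin.toℕ-inject₁ j) s)
                 (finite-cover j)

  steps-to-last : Steps (_<ᴮ_ {N}) first N last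
  steps-to-last = subst (λ n → Steps _<ᴮ_ first n last) (Fin.toℕ-fromℕ N) (steps-to-finite (fromℕ N))

-- The number 2k + s(k), from which both k and s(k) can be read off.
code : (ℕ → Bool) → ℕ → ℕ
code s k = enc (s k) k

-- The sum over k in ℕ of the blocks with parameter 2k + s(k).
Word : (ℕ → Bool) → Set
Word s = Σ ℕ λ k → Block (code s k)

module Wrd (s : ℕ → Bool) = Lex {B = λ k → Block (code s k)} ℕ._<_ _<ᴮ_

_<ᵂ_ : ∀ {s} → Rel (Word s) Level.zero
_<ᵂ_ {s} = Wrd._≺_ s

<ᵂ-isStrictTotalOrder : ∀ s → IsStrictTotalOrder _≡_ (_<ᵂ_ {s})
<ᵂ-isStrictTotalOrder s =
  Wrd.isStrictTotalOrder s ℕ.<-isStrictTotalOrder (λ k → <ᴮ-isStrictTotalOrder (code s k))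

module _ {s : ℕ → Bool} where

  -- The next blocks start with a copy of ω*, hence have no least element.
  last-rightLimit : ∀ k → RightLimit (_<ᵂ_ {s}) (k , last)
  last-rightLimit k = ((suc k , first) , Wrd.base ℕ.≤-refl) , dense
    where
    dense : ∀ y → (k , last) <ᵂ y → ∃ λ z → (k , last) <ᵂ z × z <ᵂ y
    dense (k′ , x) (Wrd.base k<k′) with block-unbounded-below x
    ... | y , y<x = (k′ , y) , Wrd.base k<k′ , Wrd.fibre y<x
    dense _ (Wrd.fibre p) = contradiction p (last-maximum _)

encode-part : ∀ {N} i → Part N i → ℕ
encode-part 0F = id
encode-part 1F = id
encode-part 2F = toℕ

encode-part-injective : ∀ {N} i → Injective _≡_ _≡_ (encode-part {N} i)
encode-part-injective 0F = id
encode-part-injective 1F = id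
encode-part-injective 2F = Fin.toℕ-injective

encode-word : ∀ {s} → Word s → ℕ
encode-word = Σ-encode id (λ _ → Σ-encode toℕ encode-part)

encode-word-injective : ∀ {s} → Injective _≡_ _≡_ (encode-word {s})
encode-word-injective = Σ-encode-injective id (λ _ → Σ-encode toℕ encode-part) id
  (λ _ → Σ-encode-injective toℕ encode-part Fin.toℕ-injective encode-part-injective)

-- Sums of copies of a word along an index order
module Sum {I : Set i} {_<_ : Rel I r} (O : IsStrictTotalOrder _≡_ _<_) where

  -- The domain of the sum, as pairs of an index and an element of the word.
  Words : (ℕ → Bool) → Set i
  Words s = I × Word s

  module Ws s = Lex {B = λ _ → Word s} _<_ _<ᵂ_

  _≺_ : ∀ {s} → Rel (Words s) (i ⊔ r)
  _≺_ {s} = Ws._≺_ s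

  ≺-isStrictTotalOrder : ∀ s → IsStrictTotalOrder _≡_ (_≺_ {s})
  ≺-isStrictTotalOrder s = Ws.isStrictTotalOrder s O (λ _ → <ᵂ-isStrictTotalOrder s)

  module _ {s : ℕ → Bool} where

    noSuccessor⇒last : ∀ {x} → NoSuccessor (_≺_ {s}) x →
                      ∃₂ λ (α : I) k → x ≡ (α , k , last)
    noSuccessor⇒last {α , k , x} none with last-or-covered x
    ... | inj₁ refl      = α , k , refl
    ... | inj₂ (y , x⋖y) = contradiction
      (Ws.fibre-cover s O (λ _ → <ᵂ-isStrictTotalOrder s)
        (Wrd.fibre-cover s ℕ.<-isStrictTotalOrder (λ k → <ᴮ-isStrictTotalOrder (code s k)) x⋖y))
      (none _)

    -- The finite part of each block is an isolated chain of code s k steps, and by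
    -- chain-length every isolated chain has such a number of steps.
    chain-start : ∀ α k → LeftLimit (_≺_ {s}) (α , k , first)
    chain-start α k = Ws.fibre-leftLimit s (Wrd.fibre-leftLimit s first-leftLimit)

    chain-end : ∀ α k → RightLimit (_≺_ {s}) (α , k , last)
    chain-end α k = Ws.fibre-rightLimit s (last-rightLimit k)

    chain-steps : ∀ α k → Steps (_≺_ {s}) (α , k , first) (code s k) (α , k , last)
    chain-steps α k = Ws.fibre-steps s O (λ _ → <ᵂ-isStrictTotalOrder s)
      (Wrd.fibre-steps s ℕ.<-isStrictTotalOrder (λ k → <ᴮ-isStrictTotalOrder (code s k)) steps-to-last)

    chain-length : ∀ {n x y} → LeftLimit (_≺_ {s}) x → Steps _≺_ x n y → RightLimit _≺_ y →
                   ∃ λ k → n ≡ code s k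
    chain-length lim st lim′ with noSuccessor⇒last (RightLimit⇒NoSuccessor _≺_ lim′)
    ... | α , k , refl = k , proj₂ (steps-unique (≺-isStrictTotalOrder s)
      (LeftLimit⇒NoPredecessor _≺_ lim) (LeftLimit⇒NoPredecessor _≺_ (chain-start α k))
      st (chain-steps α k))

  -- The image of an isolated chain with code t k steps is an isolated chain with
  -- equally many steps, so code t k equals some code s k′.  The argument in
  -- I excludes the empty index order.
  convex-embedding⇒≗ : I → ∀ {s t} (g : Words t → Words s) →
    (∀ {x y} → x ≺ y → g x ≺ g y) → (∀ {x y} → g x ≺ g y → x ≺ y) →
    (∀ {x y z} → g x ≺ z → z ≺ g y → ∃ λ w → g w ≡ z) → t ≗ s
  convex-embedding⇒≗ α {s} {t} g mono reflect convex k
    with chain-length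
           (preserves-leftLimit (≺-isStrictTotalOrder s) g mono reflect convex (chain-start α k))
           (preserves-steps (≺-isStrictTotalOrder s) g mono reflect convex (chain-steps α k))
           (preserves-rightLimit (≺-isStrictTotalOrder s) g mono reflect convex (chain-end α k))
  ... | k′ , eq with enc-injective (t k) (s k′) k k′ eq
  ...   | tk≡sk , refl = tk≡sk

-- Consequences of excluded middle
module Classical (em : ∀ {e} → ExcludedMiddle e) where

  ¬∀⇒∃¬ : {A : Set a} {P : Pred A p} → ¬ (∀ x → P x) → ∃ λ x → ¬ P x
  ¬∀⇒∃¬ ¬all = decidable-stable em λ ¬ex →
    ¬all λ x → decidable-stable em λ ¬px → ¬ex (x , ¬px)

  -- The Cantor-Schröder-Bernstein theorem.
  module CantorBernstein {A : Set a} {B : Set b}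
           (f : A → B) (f-inj : Injective _≡_ _≡_ f)
           (g : B → A) (g-inj : Injective _≡_ _≡_ g) where

    -- The points whose backward orbit under g ∘ f stops outside the image of g.
    data Orbit : Pred A (a ⊔ b) where
      start : ∀ {x} → ¬ (∃ λ y → g y ≡ x) → Orbit x
      next  : ∀ {x x′} → Orbit x → g (f x) ≡ x′ → Orbit x′

    -- The graph of the bijection: f on such points, the inverse of g elsewhere.
    Matches : A → B → Set (a ⊔ b)
    Matches x y = (Orbit x × f x ≡ y) ⊎ (¬ Orbit x × g y ≡ x)

    match : ∀ x → ∃ (Matches x)
    match x with em {P = Orbit x}
    ... | yes o = f x , inj₁ (o , refl)
    ... | no ¬o with em {P = ∃ λ y → g y ≡ x}
    ...   | yes (y , gy≡x) = y , inj₂ (¬o , gy≡x)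
    ...   | no ¬gy         = contradiction (start ¬gy) ¬o

    match⁻¹ : ∀ y → ∃ λ x → Matches x y
    match⁻¹ y with em {P = Orbit (g y)}
    ... | no ¬o               = g y , inj₂ (¬o , refl)
    ... | yes (start ¬gy)     = contradiction (y , refl) ¬gy
    ... | yes (next {x} o eq) = x , inj₁ (o , g-inj eq)

    functional : ∀ {x y y′} → Matches x y → Matches x y′ → y ≡ y′
    functional (inj₁ (_ , refl)) (inj₁ (_ , refl)) = refl
    functional (inj₁ (o , _))    (inj₂ (¬o , _))   = contradiction o ¬o
    functional (inj₂ (¬o , _))   (inj₁ (o , _))    = contradiction o ¬o
    functional (inj₂ (_ , p))    (inj₂ (_ , q))    = g-inj (trans p (sym q))

    injective : ∀ {x x′ y} → Matches x y → Matches x′ y → x ≡ x′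
    injective (inj₁ (_ , p))    (inj₁ (_ , q))    = f-inj (trans p (sym q))
    injective (inj₁ (o , refl)) (inj₂ (¬o , q))   = contradiction (next o q) ¬o
    injective (inj₂ (¬o , p))   (inj₁ (o , refl)) = contradiction (next o p) ¬o
    injective (inj₂ (_ , refl)) (inj₂ (_ , refl)) = refl

    bijection : A ↔ B
    bijection = mk↔ₛ′ (proj₁ ∘ match) (proj₁ ∘ match⁻¹)
      (λ y → functional (proj₂ (match (proj₁ (match⁻¹ y)))) (proj₂ (match⁻¹ y)))
      (λ x → injective (proj₂ (match⁻¹ (proj₁ (match x)))) (proj₂ (match x)))

  -- Arithmetic of an uncountable cardinal
  module UncountableCardinal {a} (κ : Cardinal a) (uncountable : Uncountable κ) where
    open Cardinal κ using (Carrier; _<_; isStrictTotalOrder; wellFounded; initial) public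
    private module O = IsStrictTotalOrder isStrictTotalOrder

    Limit : Pred Carrier a
    Limit = NoPredecessor _<_

    least : (P : Pred Carrier p) → ∃ P → ∃ λ x → P x × (∀ y → y < x → ¬ P y)
    least P (x , px) = go px (wellFounded x)
      where
      go : ∀ {x} → P x → Acc _<_ x → ∃ λ x → P x × (∀ y → y < x → ¬ P y)
      go {x} px (acc rs) with em {P = ∃ λ y → y < x × P y}
      ... | yes (y , y<x , py) = go py (rs y<x)
      ... | no ¬smaller        = x , px , λ y y<x py → ¬smaller (y , y<x , py)

    point : Carrier
    point = decidable-stable em λ empty →
      uncountable (mk↣ {to = λ x → contradiction x empty} λ {x} → contradiction x empty)

    upper-bound : ∀ x y → ∃ λ z → (∀ {w} → w < x → w < z) × (∀ {w} → w < y → w < z)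
    upper-bound x y with O.compare x y
    ... | tri< x<y _ _  = y , (λ w<x → O.trans w<x x<y) , id
    ... | tri≈ _ refl _ = x , id , id
    ... | tri> _ _ y<x  = x , id , (λ w<y → O.trans w<y y<x)

    -- Every element is an iterated immediate successor of a limit, its root; the
    -- number of iterations is its offset.  The least element counts as a limit.
    decompose : ∀ x → ∃₂ λ b n → Limit b × Steps _<_ b n x
    decompose x = go x (wellFounded x)
      where
      go : ∀ x → Acc _<_ x → ∃₂ λ b n → Limit b × Steps _<_ b n x
      go x (acc rs) with em {P = ∃ λ y → Cover _<_ y x}
      ... | no none = x , 0 , (λ y y⋖x → none (y , y⋖x)) , stay
      ... | yes (y , y⋖x) with go y (rs (proj₁ y⋖x))
      ...   | b , n , lim , s = b , suc n , lim , step s y⋖x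

    root : Carrier → Carrier
    root x = proj₁ (decompose x)

    offset : Carrier → ℕ
    offset x = proj₁ (proj₂ (decompose x))

    root-limit : ∀ x → Limit (root x)
    root-limit x = proj₁ (proj₂ (proj₂ (decompose x)))

    steps-from-root : ∀ x → Steps _<_ (root x) (offset x) x
    steps-from-root x = proj₂ (proj₂ (proj₂ (decompose x)))

    steps⇒root : ∀ {b n x} → Limit b → Steps _<_ b n x → root x ≡ b × offset x ≡ n
    steps⇒root lim s = steps-unique isStrictTotalOrder (root-limit _) lim (steps-from-root _) s

    root-offset-injective : ∀ {x y} → root x ≡ root y → offset x ≡ offset y → x ≡ y
    root-offset-injective {x} {y} r≡ o≡ = steps-functional isStrictTotalOrder
      (steps-from-root x)
      (subst (λ n → Steps _<_ (root x) n y) (sym o≡)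
        (subst (λ b → Steps _<_ b (offset y) y) (sym r≡) (steps-from-root y)))

    root-< : ∀ {x b} → x < b → root x < b
    root-< {x} x<b with steps-≤ isStrictTotalOrder (steps-from-root x)
    ... | inj₁ r<x = O.trans r<x x<b
    ... | inj₂ r≡x = subst (_< _) (sym r≡x) x<b

    -- Immediate successors exist below a limit, so they can be iterated there.
    steps-exist : ∀ {b c} → Limit c → b < c → ∀ n → ∃ (Steps _<_ b n)
    steps-exist {b} lim b<c zero = b , stay
    steps-exist {b} {c} lim b<c (suc n) with steps-exist lim b<c n
    ... | x , s with least (x <_) (c , steps-below isStrictTotalOrder lim b<c s)
    ...   | y , x<y , min = y , step s (x<y , λ z x<z z<y → min z z<y x<z)

    -- If b were the greatest limit, then κ would consist of the elements below b and
    -- the at most ω many successors of b.  If there is another limit z, Hilbert's hotel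
    -- makes room for these among the successors of z and injects κ below b,
    -- contradicting initiality.  Otherwise κ has at most ω many elements.
    module Hotel {b : Carrier} (lim : Limit b) (greatest : ∀ x → Limit x → ¬ (b < x)) where

      root-below : ∀ x → root x ≢ b → root x < b
      root-below x r≢b with O.compare (root x) b
      ... | tri< r<b _ _ = r<b
      ... | tri≈ _ r≡b _ = contradiction r≡b r≢b
      ... | tri> _ _ b<r = contradiction b<r (greatest _ (root-limit x))

      module _ {z : Carrier} (z-lim : Limit z) (z<b : z < b) where

        -- The graph of the injection: the bit t tells the successors of b from those of
        -- z, and elements with any other root stay fixed.
        data Moves (x y : Carrier) : Set a where
          moved : ∀ t → root x ≡ (if t then b else z) →
                  Steps _<_ z (enc t (offset x)) y → Moves x y
          fixed : root x ≢ z → x ≡ y → Moves x y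

        move : ∀ x → ∃ λ y → y < b × Moves x y
        move x with em {P = root x ≡ b} | em {P = root x ≡ z}
        ... | yes r≡b | _ = let y , s = steps-exist lim z<b (enc true (offset x)) in
          y , steps-below isStrictTotalOrder lim z<b s , moved true r≡b s
        ... | no _ | yes r≡z = let y , s = steps-exist lim z<b (enc false (offset x)) in
          y , steps-below isStrictTotalOrder lim z<b s , moved false r≡z s
        ... | no r≢b | no r≢z =
          x , steps-below isStrictTotalOrder lim (root-below x r≢b) (steps-from-root x) , fixed r≢z refl

        moves-injective : ∀ {x x′ y} → Moves x y → Moves x′ y → x ≡ x′
        moves-injective (moved t p s) (moved t′ p′ s′)
          with enc-injective t t′ _ _ (proj₂ (steps-unique isStrictTotalOrder z-lim z-lim s s′))
        ... | refl , o≡ = root-offset-injective (trans p (sym p′)) o≡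
        moves-injective (moved t p s)    (fixed r≢z refl) = contradiction (proj₁ (steps⇒root z-lim s)) r≢z
        moves-injective (fixed r≢z refl) (moved t p s)    = contradiction (proj₁ (steps⇒root z-lim s)) r≢z
        moves-injective (fixed _ refl)   (fixed _ refl)   = refl

        injection-below : ⊥
        injection-below = initial b
          ( mk↣ {to = proj₁ ∘ move}
              (λ {x} {x′} eq → moves-injective (proj₂ (proj₂ (move x)))
                 (subst (Moves x′) (sym eq) (proj₂ (proj₂ (move x′)))))
          , λ x → proj₁ (proj₂ (move x)))

      impossible : ⊥
      impossible with em {P = ∃ (_< b)}
      ... | yes (w , w<b) = injection-below (root-limit w) (root-< w<b)
      ... | no minimal    = uncountable (mk↣ {to = offset} λ {x} {y} →
              root-offset-injective (trans (root≡b x) (sym (root≡b y))))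
        where
        root≡b : ∀ x → root x ≡ b
        root≡b x = decidable-stable em λ r≢b → minimal (root x , root-below x r≢b)

    limit-above : ∀ {b} → Limit b → ∃ λ c → Limit c × b < c
    limit-above lim = decidable-stable em λ none →
      Hotel.impossible lim λ x x-lim b<x → none (x , x-lim , b<x)

    limit-above-root : ∀ x → ∃ λ c → Limit c × root x < c
    limit-above-root x = limit-above (root-limit x)

    no-maximum : ∀ x → ∃ λ y → x < y
    no-maximum x with limit-above-root x
    ... | c , lim , r<c = c , steps-below isStrictTotalOrder lim r<c (steps-from-root x)

    -- The injection κ × ℕ → κ that codes the second component into the offset.
    absorb : Carrier → ℕ → Carrier
    absorb x m = let c , lim , r<c = limit-above-root x in
      proj₁ (steps-exist lim r<c (pair (offset x) m))

    absorb-steps : ∀ x m → Steps _<_ (root x) (pair (offset x) m) (absorb x m)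
    absorb-steps x m = let c , lim , r<c = limit-above-root x in
      proj₂ (steps-exist lim r<c (pair (offset x) m))

    absorb-injective : ∀ {x y m n} → absorb x m ≡ absorb y n → x ≡ y × m ≡ n
    absorb-injective {x} {y} {m} {n} eq
      with steps-unique isStrictTotalOrder (root-limit x) (root-limit y) (absorb-steps x m)
             (subst (Steps _<_ (root y) (pair (offset y) n)) (sym eq) (absorb-steps y n))
    ... | r≡ , p≡ with pair-injective (offset x) m (offset y) n p≡
    ...   | o≡ , m≡n = root-offset-injective r≡ o≡ , m≡n

    absorb-bounded : ∀ b → ∃ λ c → ∀ {x} m → x < b → absorb x m < c
    absorb-bounded b with limit-above-root b
    ... | c , lim , r<c = c , λ {x} m x<b → steps-below isStrictTotalOrder lim
      (root-< (O.trans x<b (steps-below isStrictTotalOrder lim r<c (steps-from-root b))))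
      (absorb-steps x m)

    -- κ does not inject into B × ℕ for a bounded subset B of κ.
    no-small-injection : (f : Carrier → Carrier × ℕ) → Injective _≡_ _≡_ f →
                         ∀ b → ¬ (∀ x → proj₁ (f x) < b)
    no-small-injection f f-inj b below with absorb-bounded b
    ... | c , bounded = initial c
      ( mk↣ {to = λ x → absorb (proj₁ (f x)) (proj₂ (f x))}
          (λ eq → let p , q = absorb-injective eq in f-inj (pair-≡ p q))
      , λ x → bounded _ (below x))
      where
      pair-≡ : {x y : Carrier × ℕ} → proj₁ x ≡ proj₁ y → proj₂ x ≡ proj₂ y → x ≡ y
      pair-≡ refl refl = refl

    -- An order embedding of κ onto an interval of κ starting at β.
    module Shift (β : Carrier) where

      -- Shifted α γ: the ordinals below α correspond, in order, to the interval from β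
      -- to γ; that is, γ = β + α.  A relation replaces a recursive function, whose
      -- unfolding equation would need function extensionality.
      data Shifted (α γ : Carrier) : Set a where
        shifted : ¬ (γ < β) →
                  (∀ α′ → α′ < α → ∃ λ γ′ → γ′ < γ × Shifted α′ γ′) →
                  (∀ γ′ → γ′ < γ → ¬ (γ′ < β) → ∃ λ α′ → α′ < α × Shifted α′ γ′) →
                  Shifted α γ

      functional : ∀ {α γ γ′} → Shifted α γ → Shifted α γ′ → γ ≡ γ′
      functional = go (wellFounded _)
        where
        go : ∀ {α γ γ′} → Acc _<_ α → Shifted α γ → Shifted α γ′ → γ ≡ γ′
        not-below : ∀ {α γ γ′} → Acc _<_ α → Shifted α γ → Shifted α γ′ → ¬ (γ < γ′)
        go {γ = γ} {γ′} ac R R′ with O.compare γ γ′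
        ... | tri< γ<γ′ _ _ = contradiction γ<γ′ (not-below ac R R′)
        ... | tri≈ _ γ≡γ′ _ = γ≡γ′
        ... | tri> _ _ γ′<γ = contradiction γ′<γ (not-below ac R′ R)
        not-below (acc rs) (shifted β≤γ small _) (shifted _ _ initial-segment) γ<γ′
          with initial-segment _ γ<γ′ β≤γ
        ... | α′ , α′<α , R with small α′ α′<α
        ...   | δ , δ<γ , R′ = O.irrefl (go (rs α′<α) R′ R) δ<γ

      -- The candidates for the value at α.
      Above : Carrier → Pred Carrier a
      Above α γ = ¬ (γ < β) × (∀ α′ γ′ → α′ < α → Shifted α′ γ′ → γ′ < γ)

      not-above⇒hit : ∀ {α γ} → ¬ (γ < β) → ¬ Above α γ → ∃ λ α′ → α′ < α × Shifted α′ γ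
      not-above⇒hit {α} {γ} β≤γ ¬above = decidable-stable em λ ¬hit →
        ¬above (β≤γ , λ α′ γ′ α′<α R → below ¬hit α′<α R)
        where
        below : ¬ (∃ λ α′ → α′ < α × Shifted α′ γ) → ∀ {α′ γ′} → α′ < α → Shifted α′ γ′ → γ′ < γ
        below ¬hit {α′} {γ′} α′<α R with O.compare γ′ γ
        ... | tri< γ′<γ _ _ = γ′<γ
        ... | tri≈ _ refl _ = contradiction (α′ , α′<α , R) ¬hit
        below ¬hit {α′} {γ′} α′<α (shifted _ _ initial-segment) | tri> _ _ γ<γ′
          with initial-segment γ γ<γ′ β≤γ
        ... | α″ , α″<α′ , R = contradiction (α″ , O.trans α″<α′ α′<α , R) ¬hit

      -- Without a candidate at α, every element from β on would correspond to an
      -- element below α, so κ would inject into the disjoint union of the segments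
      -- below β and below α.
      module Exhausted (α : Carrier) (none : ¬ ∃ (Above α)) where

        δ : Carrier
        δ = proj₁ (upper-bound β α)

        -- The graph of this injection; the second component marks the summand.
        data Split (x : Carrier) : Carrier × ℕ → Set a where
          below : Split x (x , 0)
          hit   : ∀ {α′} → Shifted α′ x → Split x (α′ , 1)

        split : ∀ x → ∃ λ p → proj₁ p < δ × Split x p
        split x with em {P = x < β}
        ... | yes x<β = (x , 0) , proj₁ (proj₂ (upper-bound β α)) x<β , below
        ... | no β≤x with not-above⇒hit β≤x (λ above → none (x , above))
        ...   | α′ , α′<α , R = (α′ , 1) , proj₂ (proj₂ (upper-bound β α)) α′<α , hit R

        split-injective : ∀ {x y p} → Split x p → Split y p → x ≡ y
        split-injective below   below   = refl
        split-injective (hit R) (hit S) = functional R S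

        impossible : ⊥
        impossible = no-small-injection (proj₁ ∘ split)
          (λ {x} {y} eq → split-injective (proj₂ (proj₂ (split x)))
            (subst (Split y) (sym eq) (proj₂ (proj₂ (split y)))))
          δ (λ x → proj₁ (proj₂ (split x)))

      -- The value at α is the least candidate.
      total : ∀ α → ∃ (Shifted α)
      total α = go α (wellFounded α)
        where
        go : ∀ α → Acc _<_ α → ∃ (Shifted α)
        go α (acc rs) with least (Above α) (decidable-stable em (Exhausted.impossible α))
        ... | γ , (β≤γ , bound) , min = γ , shifted β≤γ
          (λ α′ α′<α → let γ′ , R = go α′ (rs α′<α) in γ′ , bound α′ γ′ α′<α R , R)
          (λ γ′ γ′<γ β≤γ′ → not-above⇒hit β≤γ′ (min γ′ γ′<γ))

      shift : Carrier → Carrier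
      shift α = proj₁ (total α)

      shift-≥ : ∀ α → ¬ (shift α < β)
      shift-≥ α with total α
      ... | _ , shifted β≤γ _ _ = β≤γ

      shift-mono : ∀ {α α′} → α < α′ → shift α < shift α′
      shift-mono {α} {α′} α<α′ with total α′
      ... | γ , shifted _ small _ with small α α<α′
      ...   | γ′ , γ′<γ , R = subst (_< γ) (functional R (proj₂ (total α))) γ′<γ

      shift-initial : ∀ {α γ} → ¬ (γ < β) → γ < shift α → ∃ λ α′ → shift α′ ≡ γ
      shift-initial {α} β≤γ γ<hα with total α
      ... | _ , shifted _ _ initial-segment with initial-segment _ γ<hα β≤γ
      ...   | α′ , _ , R = α′ , functional (proj₂ (total α′)) R

-- Convex embeddings of linear orders

-- An embedding whose range is convex.
IsConvexEmbedding : (L M : LinearOrder a) → (LinearOrder.Carrier L → LinearOrder.Carrier M) → Set a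
IsConvexEmbedding L M f = IsEmbedding L M f × Convex M (λ y → ∃ λ x → f x ≡ y)

_≼ᶜ_ : Rel (LinearOrder a) a
L ≼ᶜ M = ∃ (IsConvexEmbedding L M)

module _ {L M : LinearOrder a} where
  private
    module L = LinearOrder L
    module M = LinearOrder M
    module TL = IsTotalOrder L.isTotalOrder
    module TM = IsTotalOrder M.isTotalOrder

  embedding-injective : ∀ {f} → IsEmbedding L M f → Injective _≡_ _≡_ f
  embedding-injective emb {x} {y} eq = TL.antisym
    (Equivalence.from (emb x y) (TM.reflexive eq))
    (Equivalence.from (emb y x) (TM.reflexive (sym eq)))

  image-convex : ∀ {f} → IsConvexEmbedding L M f →
                 {P : Pred L.Carrier a} → Convex L P → Convex M (Image f P)
  image-convex {f} (emb , conv) P-conv x≤y y≤z (u , u∈P , refl) (w , w∈P , refl)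
    with conv x≤y y≤z (u , refl) (w , refl)
  ... | v , refl = v , P-conv (Equivalence.from (emb u v) x≤y) (Equivalence.from (emb v w) y≤z) u∈P w∈P , refl

module _ {L M N : LinearOrder a} where
  private
    module L = LinearOrder L
    module M = LinearOrder M
    module N = LinearOrder N

  ∘-embedding : ∀ {f g} → IsEmbedding L M f → IsEmbedding M N g → IsEmbedding L N (g ∘ f)
  ∘-embedding {f} f-emb g-emb x y = mk⇔
    (Equivalence.to (g-emb (f x) (f y)) ∘ Equivalence.to (f-emb x y))
    (Equivalence.from (f-emb x y) ∘ Equivalence.from (g-emb (f x) (f y)))

  ≼ᶜ-trans : L ≼ᶜ M → M ≼ᶜ N → L ≼ᶜ N
  ≼ᶜ-trans (f , f-emb , f-conv) (g , g-emb , g-conv) = g ∘ f , ∘-embedding f-emb g-emb , conv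
    where
    conv : Convex N (λ y → ∃ λ x → g (f x) ≡ y)
    conv x≤y y≤z (u , refl) (w , refl) with g-conv x≤y y≤z (f u , refl) (f w , refl)
    ... | v , refl with f-conv (Equivalence.from (g-emb _ _) x≤y) (Equivalence.from (g-emb _ _) y≤z)
                               (u , refl) (w , refl)
    ...   | v′ , refl = v′ , refl

  -- A convex embedding into N whose range lies in the image of a convex set P of M
  -- factors through a convex embedding into M.
  lift-through-image : ∀ {e P} → IsEmbedding M N e → Convex M P →
                       ((h , _) : L ≼ᶜ N) → (∀ x → h x ∈ Image e P) → L ≼ᶜ M
  lift-through-image {e} {P} e-emb P-conv (h , h-emb , h-conv) hits = g , emb , conv
    where
    g : L.Carrier → M.Carrier
    g x = proj₁ (hits x)
    g∈P : ∀ x → g x ∈ P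
    g∈P x = proj₁ (proj₂ (hits x))
    eg≡h : ∀ x → e (g x) ≡ h x
    eg≡h x = proj₂ (proj₂ (hits x))
    emb : IsEmbedding L M g
    emb x y with e-emb (g x) (g y) | h-emb x y
    ... | e⇔ | h⇔ rewrite eg≡h x | eg≡h y = mk⇔
      (Equivalence.from e⇔ ∘ Equivalence.to h⇔) (Equivalence.from h⇔ ∘ Equivalence.to e⇔)
    conv : Convex M (λ y → ∃ λ x → g x ≡ y)
    conv {y = y} x≤y y≤z (u , refl) (w , refl)
      with h-conv (subst (N._≤ e y) (eg≡h u) (Equivalence.to (e-emb _ _) x≤y))
                  (subst (e y N.≤_) (eg≡h w) (Equivalence.to (e-emb _ _) y≤z))
                  (u , refl) (w , refl)
    ... | v , hv≡ey = v , embedding-injective {L = M} {M = N} e-emb (trans (eg≡h v) hv≡ey)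

-- The transport of a linear order along a bijection.
module _ {A B : Set a} (φ : A ↔ B) (M : LinearOrderOn B) where
  private
    module φ = Inverse φ
    module M = LinearOrderOn M
    module T = IsTotalOrder M.isTotalOrder

  pullback : LinearOrderOn A
  pullback = record
    { _≤_ = λ x y → φ.to x M.≤ φ.to y
    ; isTotalOrder = record
      { isPartialOrder = record
        { isPreorder = record
          { isEquivalence = isEquivalence
          ; reflexive     = λ { refl → T.refl }
          ; trans         = T.trans }
        ; antisym = λ p q → trans (sym (φ.strictlyInverseʳ _))
                              (trans (cong φ.from (T.antisym p q)) (φ.strictlyInverseʳ _)) }
      ; total = λ x y → T.total (φ.to x) (φ.to y) }
    ; nonempty = φ.from M.nonempty }

  pullback-≼ᶜ : ⌊ pullback ⌋ ≼ᶜ ⌊ M ⌋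
  pullback-≼ᶜ = φ.to , (λ _ _ → mk⇔ id id) , λ {_} {y} _ _ _ _ → φ.from y , φ.strictlyInverseˡ y

-- The reflexive order of a strict total order.
module _ {A : Set a} {_<_ : Rel A a} (O : IsStrictTotalOrder _≡_ _<_) where
  private module O = IsStrictTotalOrder O
  open ToNonStrict _≡_ _<_ using (_≤_)

  fromStrict : A → LinearOrderOn A
  fromStrict x = record
    { _≤_ = _≤_ ; isTotalOrder = ToNonStrict.isTotalOrder _≡_ _<_ O ; nonempty = x }

  ≤⇒≯ : ∀ {x y} → x ≤ y → ¬ (y < x)
  ≤⇒≯ (inj₁ x<y)  y<x = O.asym x<y y<x
  ≤⇒≯ (inj₂ refl) x<x = O.irrefl refl x<x

  ≤-<-trans : ∀ {x y z} → x ≤ y → y < z → x < z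
  ≤-<-trans (inj₁ x<y)  y<z = O.trans x<y y<z
  ≤-<-trans (inj₂ refl) y<z = y<z

  <-≤-trans : ∀ {x y z} → x < y → y ≤ z → x < z
  <-≤-trans x<y (inj₁ y<z)  = O.trans x<y y<z
  <-≤-trans x<y (inj₂ refl) = x<y

  ≯⇒≤ : ∀ {x y} → ¬ (y < x) → x ≤ y
  ≯⇒≤ {x} {y} y≮x with O.compare x y
  ... | tri< x<y _ _ = inj₁ x<y
  ... | tri≈ _ x≡y _ = inj₂ x≡y
  ... | tri> _ _ y<x = contradiction y<x y≮x

module _ {A B : Set a} {_<₁_ : Rel A a} {_<₂_ : Rel B a}
         (O₁ : IsStrictTotalOrder _≡_ _<₁_) (O₂ : IsStrictTotalOrder _≡_ _<₂_) (x₁ : A) (x₂ : B) where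
  private
    module O₁ = IsStrictTotalOrder O₁
    M N : LinearOrder a
    M = ⌊ fromStrict O₁ x₁ ⌋
    N = ⌊ fromStrict O₂ x₂ ⌋

  mono⇒embedding : ∀ {f} → (∀ {x y} → x <₁ y → f x <₂ f y) → IsEmbedding M N f
  mono⇒embedding {f} mono x y = mk⇔
    (λ { (inj₁ x<y) → inj₁ (mono x<y) ; (inj₂ refl) → inj₂ refl })
    (λ fx≤fy → ≯⇒≤ O₁ (λ y<x → ≤⇒≯ O₂ fx≤fy (mono y<x)))

  embedding⇒mono : ∀ {f} → IsEmbedding M N f → ∀ {x y} → x <₁ y → f x <₂ f y
  embedding⇒mono emb {x} {y} x<y with Equivalence.to (emb x y) (inj₁ x<y)
  ... | inj₁ fx<fy = fx<fy
  ... | inj₂ fx≡fy = contradiction (embedding-injective {L = M} {M = N} emb fx≡fy) λ x≡y → O₁.irrefl x≡y x<y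

  embedding⇒reflect : ∀ {f} → IsEmbedding M N f → ∀ {x y} → f x <₂ f y → x <₁ y
  embedding⇒reflect emb {x} {y} fx<fy with Equivalence.from (emb x y) (inj₁ fx<fy)
  ... | inj₁ x<y  = x<y
  ... | inj₂ refl = contradiction fx<fy (≤⇒≯ O₂ (inj₂ refl))

-- The one-point order.
one : LinearOrder a
one = ⌊ record
  { _≤_          = λ _ _ → ⊤
  ; isTotalOrder = record
    { isPartialOrder = record
      { isPreorder = record { isEquivalence = isEquivalence ; reflexive = λ _ → tt ; trans = λ _ _ → tt }
      ; antisym    = λ _ _ → refl }
    ; total = λ _ _ → inj₁ tt }
  ; nonempty = tt } ⌋

one-≼ : (L : LinearOrder a) → one ≼ L
one-≼ L = (λ _ → L.nonempty) , λ _ _ → mk⇔ (λ _ → IsTotalOrder.refl L.isTotalOrder) (λ _ → tt)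
  where module L = LinearOrder L

trivialPartition : (L : LinearOrder a) → ConvexPartition one L
trivialPartition L = record
  { part     = λ _ _ → ⊤
  ; inhabits = λ _ → L.nonempty , tt
  ; covers   = λ _ → tt , tt
  ; disjoint = λ _ _ → refl
  ; ordered  = λ _ _ → mk⇔ (λ { (_ , k≢k) → contradiction refl k≢k })
      (λ lt → contradiction refl (proj₂ (lt {L.nonempty} {L.nonempty} tt tt))) }
  where module L = LinearOrder L

-- A convex embedding is a piecewise convex embedding with a single piece.
≼ᶜ⇒⊴ : (𝓛 : Pred (LinearOrder a) p) → Satisfiable 𝓛 → DownwardClosed 𝓛 →
       ∀ {L M} → L ≼ᶜ M → L ⊴⟨ 𝓛 ⟩ M
≼ᶜ⇒⊴ 𝓛 (K , K∈𝓛) closed {L} {M} (f , emb , conv) =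
  one , closed (one-≼ K) K∈𝓛 , trivialPartition L , f , emb , λ _ →
    image-convex {L = L} {M = M} (emb , conv) (λ _ _ _ _ → tt)

-- Sums of κ copies of a word
module SumsAlongCardinal (em : ∀ {e} → ExcludedMiddle e) {a} (κ cofκ : Cardinal a)
         (uncountable : Uncountable κ) (isCof : IsCofinality κ cofκ) where
  open Classical em
  open UncountableCardinal κ uncountable
  open Sum isStrictTotalOrder
  private module O = IsStrictTotalOrder isStrictTotalOrder

  part-convex : {K L : LinearOrder a} (P : ConvexPartition K L) →
                ∀ k → Convex L (ConvexPartition.part P k)
  part-convex {K} {L} P k {x} {y} {z} x≤y y≤z x∈k z∈k with ConvexPartition.covers P y
  ... | k′ , y∈k′ with em {P = k ≡ k′}
  ...   | yes refl = y∈k′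
  ...   | no k≢k′ with IsTotalOrder.total (LinearOrder.isTotalOrder K) k k′
  ...     | inj₁ k≤k′ =
    let z≤y , z≢y = Equivalence.to (ConvexPartition.ordered P k k′) (k≤k′ , k≢k′) z∈k y∈k′
    in contradiction (IsTotalOrder.antisym (LinearOrder.isTotalOrder L) z≤y y≤z) z≢y
  ...     | inj₂ k′≤k =
    let y≤x , y≢x = Equivalence.to (ConvexPartition.ordered P k′ k) (k′≤k , k≢k′ ∘ sym) y∈k′ x∈k
    in contradiction (IsTotalOrder.antisym (LinearOrder.isTotalOrder L) y≤x x≤y) y≢x

  -- Bounded f P b: the image of P under f lies strictly below b.
  Bounded : {A : Set a} → (A → Carrier) → Pred A a → Pred Carrier a
  Bounded f P b = ∀ x → x ∈ P → f x < b

  module _ {K A : Set a} {part : K → Pred A a} {f : A → Carrier}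
           (bound : ∀ k → ∃ (Bounded f (part k))) where

    -- The set of the chosen bounds.  Passing through a Boolean makes membership
    -- irrelevant, and index recovers a part from each bound.
    Bounds : Pred Carrier a
    Bounds y = Lift a (True (em {P = ∃ λ k → proj₁ (bound k) ≡ y}))

    index : ∃ Bounds → K
    index (_ , y∈B) = proj₁ (toWitness (lower y∈B))

    index-injective : Injective _≡_ _≡_ index
    index-injective {y , lift p} {z , lift q} eq
      with trans (sym (proj₂ (toWitness p))) (trans (cong (proj₁ ∘ bound) eq) (proj₂ (toWitness q)))
    ... | refl = cong (λ r → y , lift r) (T-irrelevant p q)

    cofinal-bounds : (∀ x → ∃ λ y → y ∈ Bounds × Cardinal._≤_ κ x y) → Cardinal.Carrier cofκ ↣ K
    cofinal-bounds cofinal = mk↣ {to = index ∘ Injection.to size}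
      (Injection.injective size ∘ index-injective)
      where
      size : Cardinal.Carrier cofκ ↣ ∃ Bounds
      size = IsCofinality.least isCof record
        { C          = Bounds
        ; irrelevant = λ { (lift p) (lift q) → cong lift (T-irrelevant p q) }
        ; cofinal    = cofinal }

  -- If all parts had bounded images, the set of their bounds could not be cofinal,
  -- since it injects into K; so some element would bound the image of all of A.
  unbounded-part : {K A : Set a} → ¬ (Cardinal.Carrier cofκ ↣ K) →
                   (part : K → Pred A a) → (∀ x → ∃ λ k → x ∈ part k) →
                   (f : A → Carrier) → (∀ b → ¬ (∀ x → f x < b)) →
                   ∃ λ k → ∀ b → ¬ Bounded f (part k) b
  unbounded-part small part covers f unbounded = decidable-stable em λ none →
    let bound : ∀ k → ∃ (Bounded f (part k))
        bound k = decidable-stable em λ ¬bound → none (k , λ b bd → ¬bound (b , bd))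
        b , b-above = ¬∀⇒∃¬ (small ∘ cofinal-bounds bound)
    in unbounded b λ x →
         let k , x∈k = covers x in
         O.trans (proj₂ (bound k) x x∈k)
           (decidable-stable em λ ≮b → b-above
              (proj₁ (bound k) , lift (fromWitness (k , refl)) , ≯⇒≤ isStrictTotalOrder ≮b))

  origin : ∀ {s} → Words s
  origin = point , 0 , first

  -- The sum of κ copies of the word of s.
  ⟦_⟧ : (ℕ → Bool) → LinearOrder a
  ⟦ s ⟧ = ⌊ fromStrict (≺-isStrictTotalOrder s) origin ⌋

  -- Abstract, because only the convex embedding F-≼ᶜ into the sum matters later on,
  -- not the particular bijection.
  abstract
    enumeration : ∀ s → Carrier ↔ Words s
    enumeration s = CantorBernstein.bijection
      (λ α → α , 0 , first) (λ { refl → refl })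
      (λ (α , w) → absorb α (encode-word w))
      (λ {(α , w)} {(α′ , w′)} eq → same (absorb-injective eq))
      where
      same : ∀ {α α′ : Carrier} {w w′ : Word s} →
             α ≡ α′ × encode-word w ≡ encode-word w′ → (α , w) ≡ (α′ , w′)
      same (refl , eq) = cong (_ ,_) (encode-word-injective eq)

    -- The same order with domain κ.
    F : (ℕ → Bool) → LO κ
    F s = pullback (enumeration s) (LinearOrder.order ⟦ s ⟧)

    F-≼ᶜ : ∀ s → ⌊ F s ⌋ ≼ᶜ ⟦ s ⟧
    F-≼ᶜ s = pullback-≼ᶜ (enumeration s) (LinearOrder.order ⟦ s ⟧)

  -- The convex embedding of the sum into its tail from the index β on.
  module _ {s : ℕ → Bool} (β : Carrier) where
    open Shift β

    tail-embedding : Words s → Words s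
    tail-embedding (α , w) = shift α , w

    ≤⇒index-≯ : ∀ {x y : Words s} → LinearOrder._≤_ ⟦ s ⟧ x y → ¬ (proj₁ y < proj₁ x)
    ≤⇒index-≯ x≤y y<x = ≤⇒≯ (≺-isStrictTotalOrder s) x≤y (Ws.base y<x)

    tail-embedding-convex : IsConvexEmbedding ⟦ s ⟧ ⟦ s ⟧ tail-embedding
    tail-embedding-convex =
      mono⇒embedding (≺-isStrictTotalOrder s) (≺-isStrictTotalOrder s) origin origin
        (λ { (Ws.base α<α′) → Ws.base (shift-mono α<α′) ; (Ws.fibre p) → Ws.fibre p }) ,
      λ { {y = γ , w} x≤y y≤z ((α , _) , refl) ((α′ , _) , refl) →
          let α″ , eq = in-range (≤⇒index-≯ x≤y) (≤⇒index-≯ y≤z) in (α″ , w) , cong (_, w) eq }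
      where
      in-range : ∀ {α γ α′} → ¬ (γ < shift α) → ¬ (shift α′ < γ) → ∃ λ α″ → shift α″ ≡ γ
      in-range {α} {γ} {α′} ≮ ≯ with ≯⇒≤ isStrictTotalOrder ≯
      ... | inj₂ refl  = α′ , refl
      ... | inj₁ γ<hα′ = shift-initial (λ γ<β → shift-≥ α
              (≤-<-trans isStrictTotalOrder (≯⇒≤ isStrictTotalOrder ≮) γ<β)) γ<hα′

  ⟦⟧-≼ᶜ⇒≗ : ∀ {s t} → ⟦ t ⟧ ≼ᶜ ⟦ s ⟧ → t ≗ s
  ⟦⟧-≼ᶜ⇒≗ {s} {t} (g , emb , conv) = convex-embedding⇒≗ point {s} {t} g
    (embedding⇒mono Oₜ Oₛ origin origin emb) (embedding⇒reflect Oₜ Oₛ origin origin emb)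
    (λ {x} {y} {z} p q → conv {g x} {z} {g y} (inj₁ p) (inj₁ q) (x , refl) (y , refl))
    where
    Oₛ : IsStrictTotalOrder _≡_ (_≺_ {s})
    Oₛ = ≺-isStrictTotalOrder s
    Oₜ : IsStrictTotalOrder _≡_ (_≺_ {t})
    Oₜ = ≺-isStrictTotalOrder t

  -- A convex subset of the sum with unbounded indices contains every element whose
  -- index exceeds that of one of its elements, hence a tail.
  unbounded-convex-image⇒≼ᶜ :
    ∀ {s} (L : LinearOrder a) {e : LinearOrder.Carrier L → Words s} {I : Pred (LinearOrder.Carrier L) a} →
    IsEmbedding L ⟦ s ⟧ e → Convex L I → Convex ⟦ s ⟧ (Image e I) →
    ∃ I → (∀ b → ¬ Bounded (proj₁ ∘ e) I b) → ⟦ s ⟧ ≼ᶜ L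
  unbounded-convex-image⇒≼ᶜ {s} L {e} {I} e-emb I-conv image-conv (x , x∈I) unbounded =
    lift-through-image {L = ⟦ s ⟧} {M = L} {N = ⟦ s ⟧} e-emb I-conv
      (tail-embedding β , tail-embedding-convex β) (λ (α , w) → hits (Shift.shift-≥ β α))
    where
    -- The tail starts strictly above the index of the given element of I.
    β : Carrier
    β = proj₁ (no-maximum (proj₁ (e x)))

    beyond : ∀ b → ∃ λ z → z ∈ I × ¬ (proj₁ (e z) < b)
    beyond b = decidable-stable em λ none → unbounded b λ z z∈I →
      decidable-stable em λ z≮b → none (z , z∈I , z≮b)

    hits : ∀ {γ w} → ¬ (γ < β) → (γ , w) ∈ Image e I
    hits {γ} {w} β≤γ with no-maximum γ
    ... | γ⁺ , γ<γ⁺ with beyond γ⁺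
    ...   | z , z∈I , z≮γ⁺ = image-conv
      (inj₁ (Ws.base (<-≤-trans isStrictTotalOrder (proj₂ (no-maximum (proj₁ (e x))))
                                                   (≯⇒≤ isStrictTotalOrder β≤γ))))
      (inj₁ (Ws.base (<-≤-trans isStrictTotalOrder γ<γ⁺ (≯⇒≤ isStrictTotalOrder z≮γ⁺))))
      (x , x∈I , refl) (z , z∈I , refl)

  unbounded-index : ∀ {s} (L : LO κ) {e : Carrier → Words s} → IsEmbedding ⌊ L ⌋ ⟦ s ⟧ e →
                    ∀ b → ¬ (∀ x → proj₁ (e x) < b)
  unbounded-index {s} L {e} e-emb = no-small-injection (λ x → proj₁ (e x) , encode-word (proj₂ (e x)))
    (λ eq → embedding-injective {L = ⌊ L ⌋} {M = ⟦ s ⟧} e-emb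
              (words-≡ (cong proj₁ eq) (cong proj₂ eq)))
    where
    words-≡ : ∀ {x y : Words s} → proj₁ x ≡ proj₁ y → encode-word (proj₂ x) ≡ encode-word (proj₂ y) → x ≡ y
    words-≡ refl eq = cong (_ ,_) (encode-word-injective eq)

  module _ (𝓛 : Pred (LinearOrder a) p) (𝓛⊆ : 𝓛 ⊆ LO< cofκ) where

    -- For arbitrary L this lemma yields minimality, and for L = F t incomparability.
    ⊴F⇒≼ᶜ : ∀ {s} (L : LO κ) → Restricted⊴ 𝓛 κ L (F s) → ⟦ s ⟧ ≼ᶜ ⌊ L ⌋
    ⊴F⇒≼ᶜ {s} L (K , K∈𝓛 , P , f , f-emb , f-conv) =
      let k , unbounded = unbounded-part (proj₂ (𝓛⊆ K∈𝓛)) P.part P.covers (proj₁ ∘ e) (unbounded-index L e-emb)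
      in unbounded-convex-image⇒≼ᶜ ⌊ L ⌋ e-emb (part-convex P k) (e-part-convex k) (P.inhabits k) unbounded
      where
      module P = ConvexPartition P

      e : Carrier → Words s
      e = proj₁ (F-≼ᶜ s) ∘ f

      e-emb : IsEmbedding ⌊ L ⌋ ⟦ s ⟧ e
      e-emb = ∘-embedding {L = ⌊ L ⌋} {M = ⌊ F s ⌋} {N = ⟦ s ⟧} f-emb (proj₁ (proj₂ (F-≼ᶜ s)))

      e-part-convex : ∀ k → Convex ⟦ s ⟧ (Image e (P.part k))
      e-part-convex k x≤y y≤z (u , u∈k , eu≡x) (w , w∈k , ew≡z)
        with image-convex {L = ⌊ F s ⌋} {M = ⟦ s ⟧} (proj₂ (F-≼ᶜ s))
               (f-conv k) x≤y y≤z (f u , (u , u∈k , refl) , eu≡x) (f w , (w , w∈k , refl) , ew≡z)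
      ... | _ , (v , v∈k , refl) , ev≡y = v , v∈k , ev≡y

    F-minimal : Satisfiable 𝓛 → DownwardClosed 𝓛 → ∀ s → Minimal (Restricted⊴ 𝓛 κ) (F s)
    F-minimal sat closed s (L , L⊴Fs , Fs⋬L) = Fs⋬L (≼ᶜ⇒⊴ 𝓛 sat closed {L = ⌊ F s ⌋} {M = ⌊ L ⌋}
      (≼ᶜ-trans {L = ⌊ F s ⌋} {M = ⟦ s ⟧} {N = ⌊ L ⌋} (F-≼ᶜ s) (⊴F⇒≼ᶜ L L⊴Fs)))

    F-separates : ∀ {s t} → Restricted⊴ 𝓛 κ (F s) (F t) → t ≗ s
    F-separates {s} {t} Fs⊴Ft = ⟦⟧-≼ᶜ⇒≗
      (≼ᶜ-trans {L = ⟦ t ⟧} {M = ⌊ F s ⌋} {N = ⟦ s ⟧} (⊴F⇒≼ᶜ (F s) Fs⊴Ft) (F-≼ᶜ s))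

theorem8p4 : (∀ {e} → ExcludedMiddle e) →
    ∀ {a p} (κ cofκ : Cardinal a) → Uncountable κ → IsCofinality κ cofκ →
    (𝓛 : Pred (LinearOrder a) p) → Satisfiable 𝓛 → DownwardClosed 𝓛 → 𝓛 ⊆ LO< cofκ →
    Transitive (Restricted⊴ 𝓛 κ) →
    Σ ((ℕ → Bool) → LO κ) λ F →
    (∀ s → Minimal (Restricted⊴ 𝓛 κ) (F s)) ×
    (∀ s t → ¬ (s ≗ t) → Incomparable (Restricted⊴ 𝓛 κ) (F s) (F t))
theorem8p4 em κ cofκ uncountable isCof 𝓛 sat closed 𝓛⊆ _ =
  F , F-minimal 𝓛 𝓛⊆ sat closed , λ s t s≗̸t →
    (λ Fs⊴Ft → s≗̸t (λ k → sym (F-separates 𝓛 𝓛⊆ Fs⊴Ft k))) ,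
    (λ Ft⊴Fs → s≗̸t (F-separates 𝓛 𝓛⊆ Ft⊴Fs))
  where open SumsAlongCardinal em κ cofκ uncountable isCof
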